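{- For every natural number $m$ there is a natural number $i$ such that the $i$-th term of the Ackermannian Goodstein sequence starting on $m$ is $0$, i.e. $G_i(m)=0$.
   Context: Ackermann function: for integers $k\ge 2$ and $a,b\ge 0$, define $A_a(k,b)$ by $A_a(k,-1):=1$ (auxiliary value), $A_0(k,b):=k^b$, and $A_{a+1}(k,b):=A_a(k,\cdot)^k\big(A_{a+1}(k,b-1)\big)$, where $f^j$ denotes the $j$-fold iterate of $f$. For fixed $k$ write $A_xy:=A_x(k,y)$. $k$-normal form: for $m>0$ and naturals $a,b,c$, write $m\equiv_k A_ab+c$ if $m=A_ab+c$ and there exist $n\ge 1$ and naturals $a_1,\dots,a_n$, $b_1,\dots,b_n$, $m_0,\dots,m_n$ with $m_0=0$; for each $0\le i<n$: $A_{a_{i+1}}m_i\le m<A_{a_{i+1}+1}m_i$, $A_{a_{i+1}}b_{i+1}\le m<A_{a_{i+1}}(b_{i+1}+1)$, and $m_{i+1}=A_{a_{i+1}}b_{i+1}$; $A_0m_n>m$; and $a=a_n$, $b=b_n$. Every $m>0$ has a unique such normal form; $0$ has normal form $0$. Base change: for $k,\ell\ge 2$ define $\langle k\to\ell\rangle 0=0$ and, if $m\equiv_k A_ab+c$, $\langle k\to\ell\rangle m=A_{\langle k\to\ell\rangle a}(\ell,\langle k\to\ell\rangle b)+\langle k\to\ell\rangle c$ (recursively). Ackermannian Goodstein sequence starting on $m$: $G_0(m)=m$; if $G_i(m)>0$ then $G_{i+1}(m)=\langle i+2\to i+3\rangle G_i(m)-1$; if $G_i(m)=0$ the sequence ends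 at $i$. -}

module Defs where

open import Data.Nat using (ℕ; zero; suc; _+_; _∸_; _^_; _≤_; _<_)
open import Data.Product using (_×_)
open import Relation.Binary.PropositionalEquality using (_≡_)

iter : (ℕ → ℕ) → ℕ → ℕ → ℕ
iter f zero    x = x
iter f (suc j) x = f (iter f j x)

-- Shifted Ackermann: Ack' k a n = A_a(k, n - 1), so Ack' k a 0 = A_a(k,-1) = 1.
Ack' : ℕ → ℕ → ℕ → ℕ
Ack' k a       zero    = 1
Ack' k zero    (suc b) = k ^ b
Ack' k (suc a) (suc b) = iter (λ y → Ack' k a (suc y)) k (Ack' k (suc a) b)

A : ℕ → ℕ → ℕ → ℕ
A k a b = Ack' k a (suc b)

-- NFChain k m mᵢ a b : the chain of the normal-form definition, starting at mᵢ
-- (with at least one further step) and ending with a = aₙ, b = bₙ.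
data NFChain (k m : ℕ) : ℕ → ℕ → ℕ → Set where
  last : ∀ {mi a b} →
         A k a mi ≤ m → m < A k (suc a) mi →
         A k a b ≤ m → m < A k a (suc b) →
         m < A k 0 (A k a b) →
         NFChain k m mi a b
  step : ∀ {mi a' b' a b} →
         A k a' mi ≤ m → m < A k (suc a') mi →
         A k a' b' ≤ m → m < A k a' (suc b') →
         NFChain k m (A k a' b') a b →
         NFChain k m mi a b

NF : ℕ → ℕ → ℕ → ℕ → ℕ → Set
NF k m a b c = (0 < m) × (m ≡ A k a b + c) × NFChain k m 0 a b

-- BaseChange k ℓ m m' : ⟨k → ℓ⟩ m = m'  (graph of the recursive definition)
data BaseChange (k ℓ : ℕ) : ℕ → ℕ → Set where
  bc-zero : BaseChange k ℓ 0 0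
  bc-nf   : ∀ {m a b c a' b' c'} →
            NF k m a b c →
            BaseChange k ℓ a a' → BaseChange k ℓ b b' → BaseChange k ℓ c c' →
            BaseChange k ℓ m (A ℓ a' b' + c')

data Goodstein (m : ℕ) : ℕ → ℕ → Set where
  g-zero : Goodstein m 0 m
  g-suc  : ∀ {i x y} →
           Goodstein m i x → 0 < x →
           BaseChange (i + 2) (i + 3) x y →
           Goodstein m (suc i) (y ∸ 1)

-- Hereditary normal forms are read as terms over φ (for A) and ⊞ (for +). A change of base
-- leaves the term of a number untouched, whereas m < n implies that the term of m is below
-- that of n in a well-founded lexicographic path order on terms. Hence along a Goodstein
-- sequence the subtraction of 1 makes the terms descend, and the sequence reaches 0.
--
-- That a base change f sends normal forms to normal forms is shown by strong induction on m,
-- together with the strict monotonicity of f. The lower bounds A_a(x) ≤ m, A_a(b) ≤ m in the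
-- chain of m carry over by monotonicity. For the upper bounds, m < A_a(x) does not in general
-- give f m < A_{f a}(f x); it does when x lies on the chain of m, since then m can be compared
-- with the iterates of A_{a−1} at x.

module Submission where

open import Defs
open import Data.Nat
open import Data.Nat.Properties
open import Data.Nat.Induction using (<-rec)
open import Data.Product using (∃; ∃₂; _×_; _,_; proj₁; proj₂)
open import Data.Sum using (_⊎_; inj₁; inj₂)
open import Induction.WellFounded using (Acc; acc; acc-inverse; WellFounded)
open import Relation.Nullary using (Dec; yes; no; contradiction)
open import Relation.Binary.Definitions using (tri<; tri≈; tri>)
open import Relation.Binary.PropositionalEquality

-- Iterates of inflationary and monotone functions

module _ (f : ℕ → ℕ) where

  iter-+ : ∀ i j x → iter f (i + j) x ≡ iter f i (iter f j x)
  iter-+ zero    j x = refl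
  iter-+ (suc i) j x = cong f (iter-+ i j x)

  iter-image : ∀ {n} → 0 < n → ∀ x → ∃ λ y → iter f n x ≡ f y
  iter-image {suc n} _ x = iter f n x , refl

  module _ (infl : ∀ x → x < f x) where

    iter-≥ : ∀ n x → n + x ≤ iter f n x
    iter-≥ zero    x = ≤-refl
    iter-≥ (suc n) x = <-≤-trans (s≤s (iter-≥ n x)) (infl (iter f n x))

    iter-count-mono : ∀ {i j} → i ≤ j → ∀ x → iter f i x ≤ iter f j x
    iter-count-mono {i} {j} i≤j x = begin
      iter f i x                  ≤⟨ m≤n+m _ (j ∸ i) ⟩
      (j ∸ i) + iter f i x        ≤⟨ iter-≥ (j ∸ i) _ ⟩
      iter f (j ∸ i) (iter f i x) ≡⟨ iter-+ (j ∸ i) i x ⟨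
      iter f (j ∸ i + i) x        ≡⟨ cong (λ n → iter f n x) (m∸n+n≡m i≤j) ⟩
      iter f j x                  ∎
      where open ≤-Reasoning

  module _ (mono : ∀ {x y} → x ≤ y → f x ≤ f y) where

    iter-mono : ∀ n {x y} → x ≤ y → iter f n x ≤ iter f n y
    iter-mono zero    x≤y = x≤y
    iter-mono (suc n) x≤y = mono (iter-mono n x≤y)

    iter-mono-fun : ∀ {g} → (∀ x → g x ≤ f x) → ∀ n x → iter g n x ≤ iter f n x
    iter-mono-fun g≤f zero    x = ≤-refl
    iter-mono-fun g≤f (suc n) x = ≤-trans (g≤f _) (mono (iter-mono-fun g≤f n x))

greatest : ∀ (f : ℕ → ℕ) → (∀ n → n < f n) → ∀ {m} → f 0 ≤ m →
           ∃ λ n → f n ≤ m × m < f (suc n)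
greatest f infl {m} f0≤m = search m (infl m)
  where
  search : ∀ n → m < f n → ∃ λ n → f n ≤ m × m < f (suc n)
  search zero    m<f0 = contradiction f0≤m (<⇒≱ m<f0)
  search (suc n) m<fn with f n ≤? m
  ... | yes fn≤m = n , fn≤m , m<fn
  ... | no  fn≰m = search n (≰⇒> fn≰m)

-- Links, chains and prefixes of chains

record Step (k m x a b : ℕ) : Set where
  constructor mkStep
  field
    level≤ : A k a x ≤ m
    level< : m < A k (suc a) x
    base≤  : A k a b ≤ m
    base<  : m < A k a (suc b)

open Step

data Chain (k m : ℕ) : ℕ → ℕ → ℕ → Set where
  halt : ∀ {x a b} → Step k m x a b → m < A k 0 (A k a b) → Chain k m x a b
  cons : ∀ {x a b c d} → Step k m x a b → Chain k m (A k a b) c d → Chain k m x c d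

-- The initial part of the chain of `m`, up to a point on it. Growing at the far end, it exposes the
-- link leading to that point, which a `Chain` starting there does not.
data Prefix (k m : ℕ) : ℕ → Set where
  start  : Prefix k m 0
  extend : ∀ {x} a b → Prefix k m x → Step k m x a b → Prefix k m (A k a b)

-- The Ackermann hierarchy in a fixed base

module Hierarchy (k : ℕ) (2≤k : 2 ≤ k) where

  0<k : 0 < k
  0<k = <-≤-trans z<s 2≤k

  private instance
    k≢0 : NonZero k
    k≢0 = >-nonZero 0<k

  mutual
    -- Level by level: once `A k a` is inflationary, the `k` iterations forming level `suc a` add at
    -- least `k` to their starting value.
    A-pos : ∀ a → 0 < A k a 0
    A-pos zero    = z<s
    A-pos (suc a) = <-≤-trans (<-≤-trans 0<k (m≤m+n k 1)) (iter-≥ (A k a) (A-infl a) k 1)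

    A-step : ∀ a b → A k a b < A k a (suc b)
    A-step zero    b = ^-monoʳ-< k 2≤k (n<1+n b)
    A-step (suc a) b =
      <-≤-trans (m<n+m _ 0<k) (iter-≥ (A k a) (A-infl a) k (A k (suc a) b))

    A-infl : ∀ a x → x < A k a x
    A-infl a zero    = A-pos a
    A-infl a (suc x) = ≤-<-trans (A-infl a x) (A-step a x)

  A-mono-< : ∀ a {b c} → b < c → A k a b < A k a c
  A-mono-< a {b} b<c = go (≤⇒≤′ b<c)
    where
    go : ∀ {c} → suc b ≤′ c → A k a b < A k a c
    go (≤′-reflexive refl) = A-step a b
    go (≤′-step p)         = <-trans (go p) (A-step a _)

  A-mono : ∀ a {b c} → b ≤ c → A k a b ≤ A k a c
  A-mono a b≤c with m≤n⇒m<n∨m≡n b≤c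
  ... | inj₁ b<c  = <⇒≤ (A-mono-< a b<c)
  ... | inj₂ refl = ≤-refl

  A-cancel-< : ∀ a {b c} → A k a b < A k a c → b < c
  A-cancel-< a lt = ≰⇒> λ c≤b → <⇒≱ lt (A-mono a c≤b)

  -- Each unit of the shifted argument contributes `k` iterations, down to the auxiliary value 1.
  -- Comparing levels thus becomes counting iterations.
  Ack'-iter : ∀ a n → Ack' k (suc a) n ≡ iter (A k a) (n * k) 1
  Ack'-iter a zero    = refl
  Ack'-iter a (suc n) = trans (cong (iter (A k a) k) (Ack'-iter a n)) (sym (iter-+ (A k a) k (n * k) 1))

  Ack'-infl : ∀ a n → n * k < Ack' k (suc a) n
  Ack'-infl a n = subst (n * k <_) (sym (Ack'-iter a n))
    (<-≤-trans (m<m+n (n * k) z<s) (iter-≥ (A k a) (A-infl a) (n * k) 1))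

  -- Level `suc a` ends with `k` applications of `A k a`, at least one, to a number above `b * k`,
  -- hence above `b`.
  A-level-step : ∀ a b → A k a b < A k (suc a) b
  A-level-step a b = <-≤-trans
    (A-mono-< a (≤-<-trans (m≤m*n b k) (Ack'-infl a b)))
    (iter-count-mono (A k a) (A-infl a) 0<k (Ack' k (suc a) b))

  A-level-mono : ∀ {a c} → a ≤ c → ∀ b → A k a b ≤ A k c b
  A-level-mono {a} a≤c b = go (≤⇒≤′ a≤c)
    where
    go : ∀ {c} → a ≤′ c → A k a b ≤ A k c b
    go (≤′-reflexive refl) = ≤-refl
    go (≤′-step p)         = ≤-trans (go p) (<⇒≤ (A-level-step _ b))

  A-level-cancel-< : ∀ {a c} b → A k a b < A k c b → a < c
  A-level-cancel-< b lt = ≰⇒> λ c≤a → <⇒≱ lt (A-level-mono c≤a b)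

  level<A : ∀ a b → a < A k a b
  level<A zero    b = m^n>0 k b
  level<A (suc a) b = ≤-<-trans (level<A a b) (A-level-step a b)

  -- The outermost operation in a value of level `suc a` is an application of `A k a`. At `c = 0`
  -- all values turn out to be powers of `k`.
  A-image : ∀ {a c} → c ≤ a → ∀ b → ∃ λ w → A k a b ≡ A k c w
  A-image {a} {c} c≤a b = go (≤⇒≤′ c≤a) b
    where
    go : ∀ {a} → c ≤′ a → ∀ b → ∃ λ w → A k a b ≡ A k c w
    go (≤′-reflexive refl) b = b , refl
    go (≤′-step {a} p)     b with iter-image (A k a) 0<k (Ack' k (suc a) b)
    ... | y , eq with go p y
    ... | w , eq′ = w , trans eq eq′

  A-below-next : ∀ {c a} → c < a → ∀ b → A k c (A k a b) ≤ A k a (suc b)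
  A-below-next {c} {suc a} (s≤s c≤a) b = ≤-trans
    (A-level-mono c≤a _)
    (iter-count-mono (A k a) (A-infl a) 0<k (A k (suc a) b))

  A-nonstop : ∀ a b → A k a b < A k 0 (A k a b)
  A-nonstop a b = A-infl 0 _

  -- Single links of a chain

  step-start≤ : ∀ {m x a b} → Step k m x a b → x ≤ b
  step-start≤ {a = a} s = s≤s⁻¹ (A-cancel-< a (≤-<-trans (level≤ s) (base< s)))

  step-start< : ∀ {m x a b} → Step k m x a b → x < A k a b
  step-start< {a = a} {b} s = ≤-<-trans (step-start≤ s) (A-infl a b)

  -- The upper bounds only get easier, and since `x ≤ b` both lower bounds follow from the one at
  -- `b`.
  step-shrink : ∀ {m r x a b} → A k a b ≤ r → r ≤ m → Step k m x a b → Step k r x a b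
  step-shrink {a = a} y≤r r≤m s = mkStep
    (≤-trans (A-mono a (step-start≤ s)) y≤r) (≤-<-trans r≤m (level< s))
    y≤r (≤-<-trans r≤m (base< s))

  -- With `y = A k a b`, a level `c ≥ a` would give `A k a y ≤ m`, whereas `m < A k a (suc b)` and
  -- `suc b ≤ y`.
  step-descends : ∀ {m x a b c d} → Step k m x a b → Step k m (A k a b) c d → c < a
  step-descends {a = a} {b} s t = A-level-cancel-< (A k a b)
    (≤-<-trans (level≤ t) (<-≤-trans (base< s) (A-mono a (A-infl a b))))

  step-level< : ∀ {m x a b} → Step k m x a b → a < m
  step-level< {a = a} {b} s = <-≤-trans (level<A a b) (base≤ s)

  step-base< : ∀ {m x a b} → Step k m x a b → b < m
  step-base< {a = a} {b} s = <-≤-trans (A-infl a b) (base≤ s)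

  step-compare : ∀ {n m x a b c d} → Step k n x a b → Step k m x c d → n ≤ m →
                 (a < c ⊎ (a ≡ c × b < d)) ⊎ (a ≡ c × b ≡ d)
  step-compare {x = x} {a} {b} {c} {d} s t n≤m with <-cmp a c
  ... | tri< a<c _ _ = inj₁ (inj₁ a<c)
  ... | tri> _ _ c<a = contradiction (≤-<-trans (level≤ s) (≤-<-trans n≤m (level< t)))
                         (≤⇒≯ (A-level-mono c<a x))
  ... | tri≈ _ refl _
      with m≤n⇒m<n∨m≡n (s≤s⁻¹ (A-cancel-< a (≤-<-trans (base≤ s) (≤-<-trans n≤m (base< t)))))
  ...   | inj₁ b<d  = inj₁ (inj₂ (refl , b<d))
  ...   | inj₂ b≡d = inj₂ (refl , b≡d)

  step-unique : ∀ {m x a b c d} → Step k m x a b → Step k m x c d → a ≡ c × b ≡ d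
  step-unique s t with step-compare s t ≤-refl | step-compare t s ≤-refl
  ... | inj₂ eq                 | _                         = eq
  ... | inj₁ _                  | inj₂ (refl , refl)        = refl , refl
  ... | inj₁ (inj₁ p)           | inj₁ (inj₁ q)             = contradiction p (<-asym q)
  ... | inj₁ (inj₁ p)           | inj₁ (inj₂ (refl , _))    = contradiction p (<-irrefl refl)
  ... | inj₁ (inj₂ (refl , _))  | inj₁ (inj₁ q)             = contradiction q (<-irrefl refl)
  ... | inj₁ (inj₂ (refl , p))  | inj₁ (inj₂ (_ , q))       = contradiction p (<-asym q)

  step-exists : ∀ {m x} → A k 0 x ≤ m → ∃₂ λ a b → Step k m x a b
  step-exists {m} {x} p with greatest (λ a → A k a x) (λ a → level<A a x) p
  ... | a , l≤ , l< with greatest (A k a) (A-infl a) (≤-trans (A-mono a z≤n) l≤)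
  ... | b , b≤ , b< = a , b , mkStep l≤ l< b≤ b<

  -- Chains: existence, uniqueness and comparison

  toNFChain : ∀ {m x a b} → Chain k m x a b → NFChain k m x a b
  toNFChain (halt s z) = last (level≤ s) (level< s) (base≤ s) (base< s) z
  toNFChain (cons {a = a} {b} s ch) =
    step {a' = a} {b' = b} (level≤ s) (level< s) (base≤ s) (base< s) (toNFChain ch)

  fromNFChain : ∀ {m x a b} → NFChain k m x a b → Chain k m x a b
  fromNFChain (last p q r s z)                    = halt (mkStep p q r s) z
  fromNFChain (step {a' = a} {b' = b} p q r s ch) =
    cons {a = a} {b} (mkStep p q r s) (fromNFChain ch)

  first-step : ∀ {m x a b} → Chain k m x a b → ∃₂ λ c d → Step k m x c d
  first-step (halt s _) = _ , _ , s
  first-step (cons s _) = _ , _ , s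

  chain-exists : ∀ {m x} → A k 0 x ≤ m → ∃₂ λ a b → Chain k m x a b
  chain-exists {m} {x} p = go m x (m≤m+n m x) p
    where
    -- `n` is fuel bounding `m ∸ x`; every link strictly raises the point.
    go : ∀ n x → m ≤ n + x → A k 0 x ≤ m → ∃₂ λ a b → Chain k m x a b
    go n x m≤n+x p with step-exists p
    ... | a , b , s with A k 0 (A k a b) ≤? m
    ...   | no  m≱ = a , b , halt s (≰⇒> m≱)
    go zero x m≤x p | a , b , s | yes _ = contradiction m≤x (<⇒≱ (<-≤-trans (A-infl 0 x) p))
    go (suc n) x m≤n+x p | a , b , s | yes q
      with go n (A k a b) (≤-trans (subst (m ≤_) (sym (+-suc n x)) m≤n+x)
                                   (+-monoʳ-≤ n (step-start< s))) q
    ...   | c , d , ch = c , d , cons s ch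

  chain-nonstop : ∀ {m x a b} → Chain k m x a b → A k 0 x ≤ m
  chain-nonstop {x = x} ch with first-step ch
  ... | a , b , s = ≤-trans (A-level-mono (z≤n {a}) x) (level≤ s)

  chain-unique : ∀ {m x a b c d} → Chain k m x a b → Chain k m x c d → a ≡ c × b ≡ d
  chain-unique (halt s z) (halt t _) = step-unique s t
  chain-unique (halt s z) (cons t ch) with refl , refl ← step-unique s t =
    contradiction (chain-nonstop ch) (<⇒≱ z)
  chain-unique (cons s ch) (halt t z) with refl , refl ← step-unique s t =
    contradiction (chain-nonstop ch) (<⇒≱ z)
  chain-unique (cons s ch) (cons t ch′) with refl , refl ← step-unique s t =
    chain-unique ch ch′

  chain-base≤ : ∀ {m x a b} → Chain k m x a b → A k a b ≤ m
  chain-base≤ (halt s _)  = base≤ s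
  chain-base≤ (cons _ ch) = chain-base≤ ch

  chain-start≤ : ∀ {m x a b} → Chain k m x a b → x ≤ b
  chain-start≤ (halt s _)  = step-start≤ s
  chain-start≤ (cons s ch) = ≤-trans (<⇒≤ (step-start< s)) (chain-start≤ ch)

  chain-level≤ : ∀ {m x a b c d} → Step k m x c d → Chain k m x a b → a ≤ c
  chain-level≤ t (halt s _) with refl , _ ← step-unique t s = ≤-refl
  chain-level≤ t (cons s ch) with refl , refl ← step-unique t s with first-step ch
  ... | _ , _ , u = ≤-trans (chain-level≤ u ch) (<⇒≤ (step-descends t u))

  -- No point of the chain exceeds its last value, so all links survive. Numbers between the head of
  -- `m` and `m` therefore share that head.
  chain-shrink : ∀ {m r x a b} → A k a b ≤ r → r ≤ m → Chain k m x a b → Chain k r x a b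
  chain-shrink y≤r r≤m (halt s z) = halt (step-shrink y≤r r≤m s) (≤-<-trans r≤m z)
  chain-shrink {a = a} {b} y≤r r≤m (cons s ch) = cons
    (step-shrink (≤-trans (≤-trans (chain-start≤ ch) (<⇒≤ (A-infl a b))) y≤r) r≤m s)
    (chain-shrink y≤r r≤m ch)

  step-< : ∀ {n m x a b c d} → Step k n x a b → Step k m x c d →
           a < c ⊎ (a ≡ c × b < d) → n < A k c d
  step-< {x = x} {a} {c = c} s t (inj₁ a<c) =
    <-≤-trans (level< s) (≤-trans (A-level-mono a<c x) (A-mono c (step-start≤ t)))
  step-< {a = a} s t (inj₂ (refl , b<d)) = <-≤-trans (base< s) (A-mono a b<d)

  -- Decided at the first difference. If the chain of `m` halts there, levels on the side of `n`
  -- only descend further; if it continues, `d` is at least its current link value, which is no less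
  -- than `A k a b`.
  chain-compare : ∀ {n m x a b c d} → Chain k n x a b → Chain k m x c d → n ≤ m →
                  a ≤ c ⊎ A k a b ≤ d
  chain-compare {a = a} ch ch′ n≤m with first-step ch | first-step ch′
  ... | _ , _ , s | _ , _ , t = by s t (step-compare s t n≤m) ch ch′ n≤m
    where
    le : ∀ {a b c d : ℕ} → a < c ⊎ (a ≡ c × b < d) → a ≤ c
    le (inj₁ a<c)        = <⇒≤ a<c
    le (inj₂ (refl , _)) = ≤-refl
    by : ∀ {n m x a b c d e f g h} → Step k n x e f → Step k m x g h →
         (e < g ⊎ (e ≡ g × f < h)) ⊎ (e ≡ g × f ≡ h) →
         Chain k n x a b → Chain k m x c d → n ≤ m → a ≤ c ⊎ A k a b ≤ d
    by s t (inj₁ lt) ch (halt t′ _) _ with refl , refl ← step-unique t t′ =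
      inj₁ (≤-trans (chain-level≤ s ch) (le lt))
    by s t (inj₁ lt) ch (cons t′ ch′) _ with refl , refl ← step-unique t t′ =
      inj₂ (≤-trans (chain-base≤ ch) (≤-trans (<⇒≤ (step-< s t lt)) (chain-start≤ ch′)))
    by s t (inj₂ (refl , refl)) ch ch′ n≤m with ch | ch′
    ... | halt s′ _ | halt t′ _
      with refl , refl ← step-unique s s′ | refl , refl ← step-unique t t′ =
      inj₁ ≤-refl
    ... | halt s′ _ | cons t′ ch″
      with refl , refl ← step-unique s s′ | refl , refl ← step-unique t t′ =
      inj₂ (chain-start≤ ch″)
    ... | cons s′ ch″ | halt t′ z
      with refl , refl ← step-unique s s′ | refl , refl ← step-unique t t′ =
      contradiction (chain-nonstop ch″) (<⇒≱ (≤-<-trans n≤m z))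
    ... | cons s′ ch″ | cons t′ ch‴
      with refl , refl ← step-unique s s′ | refl , refl ← step-unique t t′ =
      chain-compare ch″ ch‴ n≤m

  prefix-chain : ∀ {m x a b} → Prefix k m x → Chain k m x a b → Chain k m 0 a b
  prefix-chain start            ch = ch
  prefix-chain (extend a b p s) ch = prefix-chain p (cons s ch)

  prefix-shrink : ∀ {m r x} → x ≤ r → r ≤ m → Prefix k m x → Prefix k r x
  prefix-shrink x≤r r≤m start            = start
  prefix-shrink x≤r r≤m (extend a b p s) = extend a b
    (prefix-shrink (≤-trans (<⇒≤ (step-start< s)) x≤r) r≤m p) (step-shrink x≤r r≤m s)

  NF-intro : ∀ {m a b} → Chain k m 0 a b → NF k m a b (m ∸ A k a b)
  NF-intro {a = a} {b} ch =
    <-≤-trans (≤-<-trans z≤n (A-infl a b)) (chain-base≤ ch) ,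
    sym (m+[n∸m]≡n (chain-base≤ ch)) , toNFChain ch

  NF-exists : ∀ {m} → 0 < m → ∃₂ λ a b → NF k m a b (m ∸ A k a b)
  NF-exists 0<m with chain-exists 0<m
  ... | a , b , ch = a , b , NF-intro ch

  NF-unique : ∀ {m a b c a′ b′ c′} → NF k m a b c → NF k m a′ b′ c′ → a ≡ a′ × b ≡ b′ × c ≡ c′
  NF-unique {a = a} {b} {c} {c′ = c′} (_ , eq , ch) (_ , eq′ , ch′)
    with refl , refl ← chain-unique (fromNFChain ch) (fromNFChain ch′) =
    refl , refl , +-cancelˡ-≡ (A k a b) c c′ (trans (sym eq) eq′)

  NF-level< : ∀ {m a b c} → NF k m a b c → a < m
  NF-level< {a = a} {b} (_ , _ , ch) = <-≤-trans (level<A a b) (chain-base≤ (fromNFChain ch))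

  NF-base< : ∀ {m a b c} → NF k m a b c → b < m
  NF-base< {a = a} {b} (_ , _ , ch) = <-≤-trans (A-infl a b) (chain-base≤ (fromNFChain ch))

  NF-rest< : ∀ {m a b c} → NF k m a b c → c < m
  NF-rest< {a = a} {b} {c} (_ , refl , _) = m<n+m c (≤-<-trans z≤n (A-infl a b))

  -- By `A-image`, `A k a b` is itself `k ^ u` for some `u` not above it.
  A∣k^A : ∀ a b → ∃ λ w → A k a b * w ≡ k ^ A k a b
  A∣k^A a b with A-image {a} z≤n b
  ... | u , eq = k ^ (A k a b ∸ u) , (begin
    A k a b * k ^ (A k a b ∸ u) ≡⟨ cong (_* k ^ (A k a b ∸ u)) eq ⟩
    k ^ u * k ^ (A k a b ∸ u)   ≡⟨ ^-distribˡ-+-* k u _ ⟨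
    k ^ (u + (A k a b ∸ u))     ≡⟨ cong (k ^_) (m+[n∸m]≡n u≤) ⟩
    k ^ A k a b                 ∎)
    where
    open ≡-Reasoning
    u≤ : u ≤ A k a b
    u≤ = ≤-trans (<⇒≤ (A-infl 0 u)) (≤-reflexive (sym eq))

-- Base change preserves normal forms

module BaseChangeFunction
  (k ℓ : ℕ) (2≤k : 2 ≤ k) (k<ℓ : k < ℓ) (f : ℕ → ℕ) (f-zero : f 0 ≡ 0)
  (f-NF : ∀ {m a b c} → NF k m a b c → f m ≡ A ℓ (f a) (f b) + f c)
  where

  private
    module K = Hierarchy k 2≤k
    module L = Hierarchy ℓ (≤-trans 2≤k (<⇒≤ k<ℓ))
    instance
      k≢0 : NonZero k
      k≢0 = >-nonZero K.0<k
      ℓ≢0 : NonZero ℓ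
      ℓ≢0 = >-nonZero L.0<k

  -- Writing Z as A_{c+1}(w), the bound A_{c+1}(Z) is A_c iterated (Z − w)ℓ times at Z, and
  -- Z ≥ (w + 1)ℓ makes (Z − w)ℓ at least k(x + 1) as soon as ℓ > k.
  iter-absorbed : ∀ {c a} b {x} → c < a → x ≤ A ℓ a b →
                  iter (A ℓ c) (suc x * k) (A ℓ a b) ≤ A ℓ (suc c) (A ℓ a b)
  iter-absorbed {c} {a} b {x} c<a x≤Z with L.A-image c<a b
  ... | w , Z≡ = begin
    iter (A ℓ c) (suc x * k) Z                     ≤⟨ iter-count-mono (A ℓ c) (L.A-infl c) count Z ⟩
    iter (A ℓ c) (d * ℓ) Z                         ≡⟨ cong (iter (A ℓ c) (d * ℓ)) Z≡iter ⟩
    iter (A ℓ c) (d * ℓ) (iter (A ℓ c) (suc w * ℓ) 1) ≡⟨ iter-+ (A ℓ c) (d * ℓ) (suc w * ℓ) 1 ⟨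
    iter (A ℓ c) (d * ℓ + suc w * ℓ) 1             ≡⟨ cong (λ n → iter (A ℓ c) n 1) total ⟩
    iter (A ℓ c) (suc Z * ℓ) 1                     ≡⟨ L.Ack'-iter c (suc Z) ⟨
    A ℓ (suc c) Z                                  ∎
    where
    open ≤-Reasoning
    Z = A ℓ a b
    d = Z ∸ w
    Z≡iter : Z ≡ iter (A ℓ c) (suc w * ℓ) 1
    Z≡iter = trans Z≡ (L.Ack'-iter c (suc w))
    swℓ≤Z : suc w * ℓ ≤ Z
    swℓ≤Z = ≤-trans (<⇒≤ (L.Ack'-infl c (suc w))) (≤-reflexive (sym Z≡))
    d+w≡Z : d + w ≡ Z
    d+w≡Z = m∸n+n≡m (≤-trans (≤-trans (n≤1+n w) (m≤m*n (suc w) ℓ)) swℓ≤Z)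
    total : d * ℓ + suc w * ℓ ≡ suc Z * ℓ
    total = trans (sym (*-distribʳ-+ ℓ d (suc w)))
      (cong (_* ℓ) (trans (+-suc d w) (cong suc d+w≡Z)))
    slack : suc w * k ≤ d
    slack = +-cancelʳ-≤ w _ _ (begin
      suc w * k + w         ≤⟨ +-monoʳ-≤ (suc w * k) (n≤1+n w) ⟩
      suc w * k + suc w     ≡⟨ +-comm (suc w * k) (suc w) ⟩
      suc w + suc w * k     ≡⟨ *-suc (suc w) k ⟨
      suc w * suc k         ≤⟨ *-monoʳ-≤ (suc w) k<ℓ ⟩
      suc w * ℓ             ≤⟨ swℓ≤Z ⟩
      Z                     ≡⟨ d+w≡Z ⟨
      d + w                 ∎)
    count : suc x * k ≤ d * ℓ
    count = begin
      suc x * k             ≤⟨ *-monoˡ-≤ k (s≤s x≤Z) ⟩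
      suc Z * k             ≡⟨ cong (λ z → suc z * k) d+w≡Z ⟨
      suc (d + w) * k       ≡⟨ cong (_* k) (+-suc d w) ⟨
      (d + suc w) * k       ≡⟨ *-distribʳ-+ k d (suc w) ⟩
      d * k + suc w * k     ≤⟨ +-monoʳ-≤ (d * k) slack ⟩
      d * k + d             ≡⟨ +-comm (d * k) d ⟩
      d + d * k             ≡⟨ *-suc d k ⟨
      d * suc k             ≤⟨ *-monoʳ-≤ d k<ℓ ⟩
      d * ℓ                 ∎

  -- Proved in one simultaneous induction: the order at `m` uses the upper bounds of smaller
  -- numbers, and the upper bounds at `m` use the order.
  Monotone Stops Steps : ℕ → Set
  Monotone m = ∀ {r} → r < m → f r < f m
  Stops m    = ∀ {x} → Prefix k m x → m < A k 0 x → f m < A ℓ 0 (f x)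
  Steps m    = ∀ {x a b} → Prefix k m x → Step k m x a b → Step ℓ (f m) (f x) (f a) (f b)

  Invariant : ℕ → Set
  Invariant m = Monotone m × Stops m × Steps m

  -- Cut down to `A k a b`, the chain of `m` halts at this link with remainder 0.
  f-head : ∀ {m x a b} → Prefix k m x → Step k m x a b → f (A k a b) ≡ A ℓ (f a) (f b)
  f-head {a = a} {b} p s = begin
    f (A k a b)                ≡⟨ f-NF (K.NF-intro ch) ⟩
    Y + f (A k a b ∸ A k a b)  ≡⟨ cong (λ c → Y + f c) (n∸n≡0 (A k a b)) ⟩
    Y + f 0                    ≡⟨ cong (Y +_) f-zero ⟩
    Y + 0                      ≡⟨ +-identityʳ Y ⟩
    Y                          ∎
    where
    open ≡-Reasoning
    Y = A ℓ (f a) (f b)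
    ch = K.prefix-chain (K.prefix-shrink (<⇒≤ (K.step-start< s)) (base≤ s) p)
           (halt (K.step-shrink ≤-refl (base≤ s) s) (K.A-nonstop a b))

  -- Induction step: strict monotonicity

  module Inductive (m : ℕ) (rec : ∀ {r} → r < m → Invariant r) where

    mono< : ∀ {r s} → r < s → s < m → f r < f s
    mono< r<s s<m = proj₁ (rec s<m) r<s

    stops< : ∀ {r} → r < m → Stops r
    stops< r<m = proj₁ (proj₂ (rec r<m))

    steps< : ∀ {r} → r < m → Steps r
    steps< r<m = proj₂ (proj₂ (rec r<m))

    mono≤ : ∀ {r s} → r ≤ s → s < m → f r ≤ f s
    mono≤ r≤s s<m with m≤n⇒m<n∨m≡n r≤s
    ... | inj₁ r<s  = <⇒≤ (mono< r<s s<m)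
    ... | inj₂ refl = ≤-refl

    -- A link value is at most the base of the following link, which is less than `m`; climbing to
    -- the last link thus uses monotonicity below `m` only.
    first-lower : ∀ {x a b c d} → Prefix k m x → Chain k m x a b → Step k m x c d →
                  A ℓ (f c) (f d) ≤ f m
    first-lower {c = c} {d} p (halt s z) t with refl , refl ← K.step-unique t s =
      ≤-trans (m≤m+n _ _) (≤-reflexive (sym (f-NF (K.NF-intro (K.prefix-chain p (halt s z))))))
    first-lower {c = c} {d} p (cons s ch) t with refl , refl ← K.step-unique t s with K.first-step ch
    ... | c₂ , d₂ , u = begin
      A ℓ (f c) (f d)   ≡⟨ f-head p s ⟨
      f (A k c d)       ≤⟨ mono≤ (K.step-start≤ u) (K.step-base< u) ⟩
      f d₂              ≤⟨ <⇒≤ (L.A-infl (f c₂) (f d₂)) ⟩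
      A ℓ (f c₂) (f d₂) ≤⟨ first-lower (extend c d p s) ch u ⟩
      f m               ∎
      where open ≤-Reasoning

    diverging : ∀ {n x a b c d} → Step ℓ (f n) (f x) (f a) (f b) → Step k m x c d →
                a < c ⊎ (a ≡ c × b < d) → f n < A ℓ (f c) (f d)
    diverging {x = x} {c = c} {d} s t (inj₁ a<c) = <-≤-trans (level< s) (≤-trans
      (L.A-level-mono (mono< a<c (K.step-level< t)) (f x))
      (L.A-mono (f c) (mono≤ (K.step-start≤ t) (K.step-base< t))))
    diverging {c = c} s t (inj₂ (refl , b<d)) = <-≤-trans (base< s)
      (L.A-mono (f c) (mono< b<d (K.step-base< t)))

    halting : ∀ {n x a b} → n < m → Prefix k n x → Prefix k m x → Step k n x a b → Step k m x a b →
              n < A k 0 (A k a b) → m < A k 0 (A k a b) → f n < f m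
    halting {n} {a = a} {b} n<m p q s t z z′ = begin-strict
      f n                                 ≡⟨ f-NF (K.NF-intro (K.prefix-chain p (halt s z))) ⟩
      A ℓ (f a) (f b) + f (n ∸ A k a b)   <⟨ +-monoʳ-< (A ℓ (f a) (f b))
                                               (mono< (∸-monoˡ-< n<m (base≤ s)) (K.NF-rest< nfₘ)) ⟩
      A ℓ (f a) (f b) + f (m ∸ A k a b)   ≡⟨ f-NF nfₘ ⟨
      f m                                 ∎
      where
      open ≤-Reasoning
      nfₘ = K.NF-intro (K.prefix-chain q (halt t z′))

    outlasting : ∀ {n x a b} → n < m → Prefix k n x → Prefix k m x → n < A k 0 x →
                 Chain k m x a b → f n < f m
    outlasting {n} {x} n<m p q z ch with K.first-step ch
    ... | c , d , u = begin-strict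
      f n               <⟨ stops< n<m p z ⟩
      A ℓ 0 (f x)       ≤⟨ L.A-level-mono (z≤n {f c}) (f x) ⟩
      A ℓ (f c) (f x)   ≤⟨ L.A-mono (f c) (mono≤ (K.step-start≤ u) (K.step-base< u)) ⟩
      A ℓ (f c) (f d)   ≤⟨ first-lower q ch u ⟩
      f m               ∎
      where open ≤-Reasoning

    -- Both chains are followed to their first difference: distinct links, only the chain of `n`
    -- ending, or both ending with equal heads and different remainders.
    ordered : ∀ {n x a b c d} → n < m → Prefix k n x → Prefix k m x →
              Chain k n x a b → Chain k m x c d → f n < f m
    ordered n<m p q ch ch′ with K.first-step ch | K.first-step ch′
    ... | a , b , s | _ , _ , t with K.step-compare s t (<⇒≤ n<m)
    ... | inj₁ lt = <-≤-trans (diverging (steps< n<m p s) t lt) (first-lower q ch′ t)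
    ... | inj₂ (refl , refl) with ch | ch′
    ... | halt s′ z | halt t′ z′
      with refl , refl ← K.step-unique s s′ | refl , refl ← K.step-unique t t′ =
      halting n<m p q s t z z′
    ... | halt s′ z | cons t′ ch‴
      with refl , refl ← K.step-unique s s′ | refl , refl ← K.step-unique t t′ =
      outlasting n<m (extend a b p s) (extend a b q t) z ch‴
    ... | cons s′ ch″ | halt t′ z
      with refl , refl ← K.step-unique s s′ | refl , refl ← K.step-unique t t′ =
      contradiction (K.chain-nonstop ch″) (<⇒≱ (<-trans n<m z))
    ... | cons s′ ch″ | cons t′ ch‴
      with refl , refl ← K.step-unique s s′ | refl , refl ← K.step-unique t t′ =
      ordered n<m (extend a b p s) (extend a b q t) ch″ ch‴

    f-pos : ∀ {r} → 0 < r → r < m → 0 < f r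
    f-pos 0<r r<m = subst (_< f _) f-zero (mono< 0<r r<m)

    f-mono : Monotone m
    -- 0 has no chain and is treated apart; here positivity of `A ℓ` suffices.
    f-mono {zero} 0<m with K.NF-exists 0<m
    ... | a , b , nf = subst₂ _<_ (sym f-zero) (sym (f-NF nf))
      (<-≤-trans (≤-<-trans z≤n (L.A-infl (f a) (f b))) (m≤m+n _ _))
    f-mono {suc n} n<m with K.chain-exists {suc n} z<s | K.chain-exists {m} {0} (≤-trans z<s n<m)
    ... | _ , _ , ch | _ , _ , ch′ = ordered n<m start start ch ch′

    f-mono′ : ∀ {r s} → r < s → s ≤ m → f r < f s
    f-mono′ r<s s≤m with m≤n⇒m<n∨m≡n s≤m
    ... | inj₁ s<m  = mono< r<s s<m
    ... | inj₂ refl = f-mono r<s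

    f-≤-mono : ∀ {r s} → r ≤ s → s ≤ m → f r ≤ f s
    f-≤-mono r≤s s≤m with m≤n⇒m<n∨m≡n r≤s
    ... | inj₁ r<s  = <⇒≤ (f-mono′ r<s s≤m)
    ... | inj₂ refl = ≤-refl

    f-infl : ∀ r → r ≤ m → r ≤ f r
    f-infl zero    _   = z≤n
    f-infl (suc r) r<m = ≤-<-trans (f-infl r (<⇒≤ r<m)) (f-mono′ (n<1+n r) r<m)

    -- Induction step: upper bounds

    module _ {x a b} (p : Prefix k m x) (s : Step k m x a b) where

      private
        y = A k a b
        Y = A ℓ (f a) (f b)

      Y≡ : f y ≡ Y
      Y≡ = f-head p s

      f-below-head : ∀ {r} → r < y → f r < Y
      f-below-head r<y = subst (f _ <_) Y≡ (f-mono′ r<y (base≤ s))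

      y≤Y : y ≤ Y
      y≤Y = subst (y ≤_) Y≡ (f-infl y (base≤ s))

      -- While `y ≤ r < k ^ y`, the head of `r` is `y`, so removing one `y` from `r` removes one `Y`
      -- from `f r`.
      f-below-multiple : ∀ w {r} → r ≤ m → r < A k 0 y → r < y * w → f r < Y * w
      f-below-multiple zero    {r} r≤m z r< = contradiction (subst (r <_) (*-zeroʳ y) r<) (λ ())
      f-below-multiple (suc w) {r} r≤m z r< with r <? y
      ... | yes r<y = <-≤-trans (f-below-head r<y) (m≤m*n Y (suc w))
      ... | no  r≮y = begin-strict
        f r              ≡⟨ f-NF (K.NF-intro (K.prefix-chain (K.prefix-shrink x≤r r≤m p)
                                                             (halt (K.step-shrink y≤r r≤m s) z))) ⟩
        Y + f (r ∸ y)    <⟨ +-monoʳ-< Y (f-below-multiple w (≤-trans (m∸n≤m r y) r≤m)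
                                           (≤-<-trans (m∸n≤m r y) z) r∸y<) ⟩
        Y + Y * w        ≡⟨ *-suc Y w ⟨
        Y * suc w        ∎
        where
        open ≤-Reasoning
        y≤r = ≮⇒≥ r≮y
        x≤r = ≤-trans (<⇒≤ (K.step-start< s)) y≤r
        r∸y< : r ∸ y < y * w
        r∸y< = +-cancelˡ-< y _ _ (subst₂ _<_ (sym (m+[n∸m]≡n y≤r)) (*-suc y w) r<)

      -- y divides k^y = y w, so f m < Y w, and Y w ≤ y w (1 + d) ≤ k^(y + d) = k^Y for d = Y − y.
      stops-at : m < A k 0 y → f m < A ℓ 0 (f y)
      stops-at z with K.A∣k^A a b
      ... | w , yw≡ = subst (λ v → f m < A ℓ 0 v) (sym Y≡) (begin-strict
        f m                       <⟨ f-below-multiple w ≤-refl z (subst (m <_) (sym yw≡) z) ⟩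
        Y * w                     ≡⟨ cong (_* w) (m+[n∸m]≡n y≤Y) ⟨
        (y + d) * w               ≤⟨ *-monoˡ-≤ w (+-monoʳ-≤ y (m≤n*m d y)) ⟩
        (y + y * d) * w           ≡⟨ cong (_* w) (*-suc y d) ⟨
        (y * suc d) * w           ≡⟨ *-assoc y (suc d) w ⟩
        y * (suc d * w)           ≡⟨ cong (y *_) (*-comm (suc d) w) ⟩
        y * (w * suc d)           ≡⟨ *-assoc y w (suc d) ⟨
        (y * w) * suc d           ≡⟨ cong (_* suc d) yw≡ ⟩
        k ^ y * suc d             ≤⟨ *-monoʳ-≤ (k ^ y) (K.A-infl 0 d) ⟩
        k ^ y * k ^ d             ≡⟨ ^-distribˡ-+-* k y d ⟨
        k ^ (y + d)               ≡⟨ cong (k ^_) (m+[n∸m]≡n y≤Y) ⟩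
        k ^ Y                     ≤⟨ ^-monoˡ-≤ Y (<⇒≤ k<ℓ) ⟩
        ℓ ^ Y                     ∎)
        where
        open ≤-Reasoning
        d = Y ∸ y
        instance
          y≢0 : NonZero y
          y≢0 = >-nonZero (≤-<-trans z≤n (K.A-infl a b))

    stops : Stops m
    -- Here `x` is 0 and `A k 0 0` is 1, which forces `m` to be 0.
    stops start          m<1 with refl ← n<1⇒n≡0 m<1 rewrite f-zero = z<s
    stops (extend a b p s) z = stops-at p s z

    module _ {x γ s S} (p : Prefix k m x) (γ<m : γ < m) (m< : m < A k (suc γ) x)
             (x≤s : x ≤ s) (fx≤S : f x ≤ S) (below : ∀ {r} → r < s → f r < S) where

      -- From `s` on, `x` lies on the chain of `r`, with a level at most `γ` there. Halting or a
      -- smaller level bounds `f r` by one application to `f x`; at level `γ` the base of `r` is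
      -- below the previous iterate, and induction on `j` treats that base.
      f-below-iter : ∀ j {r} → r < m → r < iter (A k γ) j s → f r < iter (A ℓ (f γ)) j S
      f-below-iter zero    _ r<s = below r<s
      f-below-iter (suc j) {r} r<m r< with r <? s
      ... | yes r<s = <-≤-trans (below r<s)
                        (iter-count-mono (A ℓ (f γ)) (L.A-infl (f γ)) (z≤n {suc j}) S)
      ... | no  r≮s = from-x (r <? A k 0 x)
        where
        open ≤-Reasoning
        q : Prefix k r x
        q = K.prefix-shrink (≤-trans x≤s (≮⇒≥ r≮s)) (<⇒≤ r<m) p
        fx≤iter : f x ≤ iter (A ℓ (f γ)) j S
        fx≤iter = ≤-trans fx≤S (iter-count-mono (A ℓ (f γ)) (L.A-infl (f γ)) (z≤n {j}) S)
        below-level : ∀ {c} → c ≤ f γ → f r < A ℓ c (f x) → f r < A ℓ (f γ) (iter (A ℓ (f γ)) j S)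
        below-level {c} c≤fγ fr< = begin-strict
          f r                                <⟨ fr< ⟩
          A ℓ c (f x)                        ≤⟨ L.A-level-mono c≤fγ (f x) ⟩
          A ℓ (f γ) (f x)                    ≤⟨ L.A-mono (f γ) fx≤iter ⟩
          A ℓ (f γ) (iter (A ℓ (f γ)) j S)   ∎
        from-x : Dec (r < A k 0 x) → f r < A ℓ (f γ) (iter (A ℓ (f γ)) j S)
        from-x (yes z) = below-level z≤n (stops< r<m q z)
        from-x (no r≮) with K.step-exists (≮⇒≥ r≮)
        ... | a , b , t with <-cmp a γ
        ... | tri< a<γ _ _  = below-level (mono< a<γ γ<m) (level< (steps< r<m q t))
        ... | tri≈ _ refl _ = <-≤-trans (base< (steps< r<m q t)) (L.A-mono (f γ)
          (f-below-iter j (<-trans (K.step-base< t) r<m) (K.A-cancel-< γ (≤-<-trans (base≤ t) r<))))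
        ... | tri> _ _ γ<a  = contradiction
          (K.A-level-cancel-< x (≤-<-trans (level≤ t) (<-trans r<m m<))) (≤⇒≯ γ<a)

      -- `m` itself is out of reach of `f-below-iter`, but its base `b` is not; the base bound for
      -- `f m` is a premise.
      f-at-iter : ∀ j {b} → b < m → A k γ b ≤ m → m < iter (A k γ) (suc j) s →
                  f m < A ℓ (f γ) (suc (f b)) → f m < iter (A ℓ (f γ)) (suc j) S
      f-at-iter j b<m Ab≤m m<iter fm< = <-≤-trans fm<
        (L.A-mono (f γ) (f-below-iter j b<m (K.A-cancel-< γ (≤-<-trans Ab≤m m<iter))))

    -- At level 0, counting multiples of the head suffices, as `k < ℓ`. At a positive level the
    -- halting bound is absorbed by the next value of that level.
    base-upper-halt : ∀ {x a b} → Prefix k m x → Step k m x a b → m < A k 0 (A k a b) →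
                      f m < A ℓ (f a) (suc (f b))
    base-upper-halt {a = zero} {b} p s z = begin-strict
      f m                     <⟨ f-below-multiple p s k ≤-refl z
                                   (subst (m <_) (*-comm k (k ^ b)) (base< s)) ⟩
      A ℓ (f 0) (f b) * k     ≡⟨ cong (λ c → A ℓ c (f b) * k) f-zero ⟩
      ℓ ^ f b * k             ≤⟨ *-monoʳ-≤ (ℓ ^ f b) (<⇒≤ k<ℓ) ⟩
      ℓ ^ f b * ℓ             ≡⟨ *-comm (ℓ ^ f b) ℓ ⟩
      A ℓ 0 (suc (f b))       ≡⟨ cong (λ c → A ℓ c (suc (f b))) f-zero ⟨
      A ℓ (f 0) (suc (f b))   ∎
      where open ≤-Reasoning
    base-upper-halt {a = suc a} {b} p s z = begin-strict
      f m                                   <⟨ stops-at p s z ⟩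
      A ℓ 0 (f (A k (suc a) b))             ≡⟨ cong (A ℓ 0) (Y≡ p s) ⟩
      A ℓ 0 (A ℓ (f (suc a)) (f b))         ≤⟨ L.A-below-next (f-pos z<s (K.step-level< s)) (f b) ⟩
      A ℓ (f (suc a)) (suc (f b))           ∎
      where open ≤-Reasoning

    -- If the level falls by two or more, the level bound of the image link `T` is enough,
    -- `suc (f c)` being still below the image of the current level.
    base-upper-cons : ∀ {x a b c d} → Prefix k m x → Step k m x a b → Step k m (A k a b) c d →
                      Step ℓ (f m) (f (A k a b)) (f c) (f d) → f m < A ℓ (f a) (suc (f b))
    base-upper-cons p s t T with K.step-descends s t
    base-upper-cons {a = suc γ} {b} {c} p s t T | s≤s c≤γ with m≤n⇒m<n∨m≡n c≤γ
    ... | inj₁ c<γ = begin-strict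
      f m                                   <⟨ level< T ⟩
      A ℓ (suc (f c)) (f (A k (suc γ) b))   ≡⟨ cong (A ℓ (suc (f c))) (Y≡ p s) ⟩
      A ℓ (suc (f c)) Y                     ≤⟨ L.A-below-next suc-fc< (f b) ⟩
      A ℓ (f (suc γ)) (suc (f b))           ∎
      where
      open ≤-Reasoning
      Y = A ℓ (f (suc γ)) (f b)
      γ<m = <-trans (n<1+n γ) (K.step-level< s)
      suc-fc< : suc (f c) < f (suc γ)
      suc-fc< = ≤-<-trans (mono< c<γ γ<m) (mono< (n<1+n γ) (K.step-level< s))
    -- Now `suc (f γ)` may equal `f (suc γ)`, making the level bound of `T` too weak. Instead
    -- iterations are counted: `m` is below `k` iterations of `A k γ` at `y`, hence `f m` below `k`
    -- iterations of `A ℓ (f γ)` at `f y`, and `k < ℓ`.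
    ... | inj₂ refl = upper (mono< (n<1+n γ) (K.step-level< s))
      where
      y = A k (suc γ) b
      bound : f m < iter (A ℓ (f γ)) (suc (pred k)) (f y)
      bound = f-at-iter (extend (suc γ) b p s) (K.step-level< t) (level< t) ≤-refl ≤-refl
        (λ r<y → f-mono′ r<y (base≤ s)) (pred k) (K.step-base< t) (base≤ t)
        (subst (λ n → m < iter (A k γ) n y) (sym (suc-pred k)) (base< s)) (base< T)
      upper : f γ < f (suc γ) → f m < A ℓ (f (suc γ)) (suc (f b))
      upper lt with f (suc γ) in eq
      upper (s≤s {n = α} fγ≤α) | suc α = begin-strict
        f m  <⟨ bound ⟩
        iter (A ℓ (f γ)) (suc (pred k)) (f y)
          ≡⟨ cong₂ (iter (A ℓ (f γ))) (suc-pred k)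
               (trans (Y≡ p s) (cong (λ c → A ℓ c (f b)) eq)) ⟩
        iter (A ℓ (f γ)) k (A ℓ (suc α) (f b))
          ≤⟨ iter-mono-fun (A ℓ α) (L.A-mono α) (L.A-level-mono fγ≤α) k _ ⟩
        iter (A ℓ α) k (A ℓ (suc α) (f b))
          ≤⟨ iter-count-mono (A ℓ α) (L.A-infl α) (<⇒≤ k<ℓ) _ ⟩
        A ℓ (suc α) (suc (f b))  ∎
        where open ≤-Reasoning

    -- At `x = 0` level `suc a` is just `k` iterations from 1, fewer than `ℓ`. At a later point the
    -- preceding link has a higher level, so `iter-absorbed` makes room for `suc x * k` iterations
    -- at `f x`.
    level-upper : ∀ {x a b} → Prefix k m x → Step k m x a b → f m < A ℓ (f a) (suc (f b)) →
                  f m < A ℓ (suc (f a)) (f x)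
    level-upper {a = a} start s fm< = subst (λ v → f m < A ℓ (suc (f a)) v) (sym f-zero)
      (<-≤-trans bound (≤-trans (≤-reflexive (cong (λ n → iter (A ℓ (f a)) n 1) (suc-pred k)))
        (iter-count-mono (A ℓ (f a)) (L.A-infl (f a)) (<⇒≤ k<ℓ) 1)))
      where
      bound : f m < iter (A ℓ (f a)) (suc (pred k)) 1
      bound = f-at-iter start (K.step-level< s) (level< s) z≤n (≤-trans (≤-reflexive f-zero) z≤n)
        (λ r<1 → ≤-reflexive (cong suc (trans (cong f (n<1⇒n≡0 r<1)) f-zero)))
        (pred k) (K.step-base< s) (base≤ s)
        (subst (λ n → m < iter (A k a) n 1) (sym (suc-pred k)) (level< s)) fm<
    level-upper {a = a} (extend α β p t) s fm< = <-≤-trans bound (begin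
      iter (A ℓ (f a)) N (f x)  ≡⟨ cong₂ (iter (A ℓ (f a))) (suc-pred (suc x * k)) (Y≡ p t) ⟩
      iter (A ℓ (f a)) (suc x * k) (A ℓ (f α) (f β)) ≤⟨ iter-absorbed (f β) fa<fα (y≤Y p t) ⟩
      A ℓ (suc (f a)) (A ℓ (f α) (f β)) ≡⟨ cong (A ℓ (suc (f a))) (Y≡ p t) ⟨
      A ℓ (suc (f a)) (f x)     ∎)
      where
      open ≤-Reasoning
      x = A k α β
      instance
        count≢0 : NonZero (suc x * k)
        count≢0 = m*n≢0 (suc x) k
      N = suc (pred (suc x * k))
      fa<fα : f a < f α
      fa<fα = mono< (K.step-descends t s) (K.step-level< t)
      -- The iterations really start from 1; starting from `x` only enlarges the result.
      m< : m < iter (A k a) (suc x * k) x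
      m< = <-≤-trans (level< s) (≤-trans (≤-reflexive (K.Ack'-iter a (suc x)))
        (iter-mono (A k a) (K.A-mono a) (suc x * k) (≤-<-trans z≤n (K.A-infl α β))))
      bound : f m < iter (A ℓ (f a)) N (f x)
      bound = f-at-iter (extend α β p t) (K.step-level< s) (level< s) ≤-refl ≤-refl
        (λ r<x → f-mono′ r<x (base≤ t)) (pred (suc x * k)) (K.step-base< s) (base≤ s)
        (subst (λ n → m < iter (A k a) n x) (sym (suc-pred (suc x * k))) m<) fm<

    step-preserved : ∀ {x a b} → Prefix k m x → Step k m x a b → f m < A ℓ (f a) (suc (f b)) →
                     Step ℓ (f m) (f x) (f a) (f b)
    step-preserved {a = a} {b} p s fm< = mkStep
      (≤-trans (L.A-mono (f a) (mono≤ (K.step-start≤ s) (K.step-base< s))) Y≤fm)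
      (level-upper p s fm<) Y≤fm fm<
      where
      Y≤fm : A ℓ (f a) (f b) ≤ f m
      Y≤fm = ≤-trans (≤-reflexive (sym (Y≡ p s))) (f-≤-mono (base≤ s) ≤-refl)

    -- From the end of the chain backwards: the base bound of a link uses the image of the next one.
    first-step-preserved : ∀ {x a b c d} → Prefix k m x → Chain k m x c d → Step k m x a b →
                           Step ℓ (f m) (f x) (f a) (f b)
    first-step-preserved p (halt s z) t with refl , refl ← K.step-unique t s =
      step-preserved p s (base-upper-halt p s z)
    first-step-preserved p (cons s ch) t
      with refl , refl ← K.step-unique t s with K.first-step ch
    ... | _ , _ , u = step-preserved p s
      (base-upper-cons p s u (first-step-preserved (extend _ _ p s) ch u))

    steps : Steps m
    steps {x} {a} p s with K.chain-exists (≤-trans (K.A-level-mono (z≤n {a}) x) (level≤ s))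
    ... | _ , _ , ch = first-step-preserved p ch s

  invariant : ∀ m → Invariant m
  invariant = <-rec Invariant λ m rec → let open Inductive m rec in f-mono , stops , steps

  f-infl : ∀ m → m ≤ f m
  f-infl m = Inductive.f-infl m (λ {r} _ → invariant r) m ≤-refl

  chain-preserved : ∀ {m x a b} → Prefix k m x → Chain k m x a b → Chain ℓ (f m) (f x) (f a) (f b)
  chain-preserved {m} p (halt {a = a} {b} s z) = halt (proj₂ (proj₂ (invariant m)) p s)
    (subst (λ v → f m < A ℓ 0 v) (f-head p s) (proj₁ (proj₂ (invariant m)) (extend a b p s) z))
  chain-preserved {m} p (cons {a = a} {b} s ch) = cons (proj₂ (proj₂ (invariant m)) p s)
    (subst (λ v → Chain ℓ (f m) v _ _) (f-head p s) (chain-preserved (extend a b p s) ch))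

  NF-preserved : ∀ {m a b c} → NF k m a b c → NF ℓ (f m) (f a) (f b) (f c)
  NF-preserved {m} {a} {b} nf@(0<m , _ , ch) = <-≤-trans 0<m (f-infl m) , f-NF nf ,
    L.toNFChain (subst (λ v → Chain ℓ (f m) v (f a) (f b)) f-zero (chain-preserved start (K.fromNFChain ch)))

-- Terms and their well-founded order

infixr 6 _⊞_
infix 4 _≺_

data Term : Set where
  O   : Term
  φ   : Term → Term → Term
  _⊞_ : Term → Term → Term

-- A lexicographic path order in which φ s t plays the fixed-point-free Veblen function;
-- only the comparisons that occur between normal forms are included, so it is not transitive.
data _≺_ : Term → Term → Set where
  O≺φ    : ∀ {s t} → O ≺ φ s t
  inside : ∀ {r s t} → r ≺ t → r ≺ φ s t
  level  : ∀ {s t s′ t′} → s′ ≺ s → t′ ≺ φ s t → φ s′ t′ ≺ φ s t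
  base   : ∀ {s t t′} → t′ ≺ t → φ s t′ ≺ φ s t
  sum    : ∀ {p r s t} → p ≺ φ s t → r ≺ φ s t → p ⊞ r ≺ φ s t
  below  : ∀ {p q r} → q ≺ p → q ≺ p ⊞ r
  head   : ∀ {p r} → p ≺ p ⊞ r
  rest   : ∀ {p r r′} → r′ ≺ r → p ⊞ r′ ≺ p ⊞ r

acc-⊞ : ∀ {p r} → Acc _≺_ p → Acc _≺_ r → Acc _≺_ (p ⊞ r)
acc-⊞ {p} ap (acc rs) = acc λ where
  (below q≺p) → acc-inverse ap q≺p
  head        → ap
  (rest r′≺r) → acc-⊞ ap (rs r′≺r)

mutual
  acc-φ : ∀ {s t} → Acc _≺_ s → Acc _≺_ t → Acc _≺_ (φ s t)
  acc-φ as at = acc (acc-below-φ as at)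

  -- Lexicographic recursion on the accessibility of `s`, that of `t`, and the derivation of
  -- `r ≺ φ s t`; in the case `level`, a shorter derivation first handles `t′`.
  acc-below-φ : ∀ {s t} → Acc _≺_ s → Acc _≺_ t → ∀ {r} → r ≺ φ s t → Acc _≺_ r
  acc-below-φ as at O≺φ                    = acc λ ()
  acc-below-φ as at (inside r≺t)           = acc-inverse at r≺t
  acc-below-φ (acc rs) at (level s′≺s t′≺) = acc-φ (rs s′≺s) (acc-below-φ (acc rs) at t′≺)
  acc-below-φ as (acc rs) (base t′≺t)      = acc-φ as (rs t′≺t)
  acc-below-φ as at (sum p≺ r≺)            = acc-⊞ (acc-below-φ as at p≺) (acc-below-φ as at r≺)

≺-wellFounded : WellFounded _≺_
≺-wellFounded O       = acc λ ()
≺-wellFounded (φ s t) = acc-φ (≺-wellFounded s) (≺-wellFounded t)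
≺-wellFounded (p ⊞ r) = acc-⊞ (≺-wellFounded p) (≺-wellFounded r)

-- Stands in for transitivity through `p ≺ p ⊞ O`: a number equal to its own head has a term of the
-- form `p ⊞ O`.
≺-drop-O : ∀ {p t} → p ⊞ O ≺ t → p ≺ t
≺-drop-O (inside p≺t) = inside (≺-drop-O p≺t)
≺-drop-O (sum p≺t _)  = p≺t
≺-drop-O (below p≺q)  = below (≺-drop-O p≺q)
≺-drop-O head         = below head
≺-drop-O (rest _)     = head

-- Hereditary normal forms as terms

eval : ℕ → Term → ℕ
eval k O       = 0
eval k (φ s t) = A k (eval k s) (eval k t)
eval k (p ⊞ r) = eval k p + eval k r

data Notation (k : ℕ) : Term → ℕ → Set where
  zero : Notation k O 0
  node : ∀ {s t r m a b c} → NF k m a b c →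
         Notation k s a → Notation k t b → Notation k r c → Notation k (φ s t ⊞ r) m

notation-baseChange : ∀ {k ℓ t m} → Notation k t m → BaseChange k ℓ m (eval ℓ t)
notation-baseChange zero            = bc-zero
notation-baseChange (node nf s t r) =
  bc-nf nf (notation-baseChange s) (notation-baseChange t) (notation-baseChange r)

module Notations (k : ℕ) (2≤k : 2 ≤ k) where

  open Hierarchy k 2≤k

  notation-unique : ∀ {s t m} → Notation k s m → Notation k t m → s ≡ t
  notation-unique zero zero = refl
  notation-unique zero (node (() , _) _ _ _)
  notation-unique (node (() , _) _ _ _) zero
  notation-unique (node nf s t r) (node nf′ s′ t′ r′) with refl , refl , refl ← NF-unique nf nf′ =
    cong₂ _⊞_ (cong₂ φ (notation-unique s s′) (notation-unique t t′)) (notation-unique r r′)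

  notation-exists : ∀ m → ∃ λ t → Notation k t m
  notation-exists = <-rec _ λ where
    zero    rec → O , zero
    (suc m) rec → let
      a , b , nf = NF-exists {suc m} z<s
      s , s↦a = rec (NF-level< nf)
      t , t↦b = rec (NF-base< nf)
      r , r↦c = rec (NF-rest< nf)
      in φ s t ⊞ r , node nf s↦a t↦b r↦c

  Ordered : ℕ → Set
  Ordered n = ∀ {m s t} → m < n → Notation k s m → Notation k t n → s ≺ t

  module _ {n} (rec : ∀ {r} → r < n → Ordered r) where

    -- The head `A k a b` alone has the term `φ s t ⊞ O`; if it is below `e`, induction compares the
    -- terms, and if it equals `e`, that term is `w`.
    head-≺ : ∀ {e m s t w a b} → e < n → Chain k m 0 a b → A k a b ≤ e →
             Notation k s a → Notation k t b → Notation k w e → φ s t ≺ w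
    head-≺ {e} {a = a} {b} e<n ch y≤e s↦a t↦b w↦e with m≤n⇒m<n∨m≡n y≤e | y↦
      where
      y↦ : Notation k (φ _ _ ⊞ O) (A k a b)
      y↦ = node (NF-intro (chain-shrink ≤-refl (chain-base≤ ch) ch)) s↦a t↦b
        (subst (Notation k O) (sym (n∸n≡0 (A k a b))) zero)
    ... | inj₁ y<e  | y↦ = ≺-drop-O (rec e<n y<e y↦ w↦e)
    ... | inj₂ refl | y↦ with refl ← notation-unique y↦ w↦e = head

    -- Recursion treats the remainder of `m`, so `sum` leaves its head. By `chain-compare` the head
    -- fits inside the base `d`, or its level is at most `c` and levels or bases are compared.
    below-head-≺ : ∀ {c d q u v m s} → NF k n c d q → Notation k u c → Notation k v d →
                   m < A k c d → Notation k s m → s ≺ φ u v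
    below-head-≺ nf u↦ v↦ m<y zero = O≺φ
    below-head-≺ {c} {d} {u = u} {v} nf@(_ , _ , nch) u↦ v↦ m<y
        (node {s} {t} {a = a} nf′@(_ , _ , mch) s↦ t↦ r↦) =
      sum headed (below-head-≺ nf u↦ v↦ (<-trans (NF-rest< nf′) m<y) r↦)
      where
      y≤n = chain-base≤ (fromNFChain nch)
      headed : φ s t ≺ φ u v
      headed with chain-compare (fromNFChain mch) (fromNFChain nch) (<⇒≤ (<-≤-trans m<y y≤n))
      ... | inj₂ y′≤d = inside (head-≺ (NF-base< nf) (fromNFChain mch) y′≤d s↦ t↦ v↦)
      ... | inj₁ a≤c with m≤n⇒m<n∨m≡n a≤c
      ...   | inj₁ a<c = level (rec (NF-level< nf) a<c s↦ u↦)
                           (below-head-≺ nf u↦ v↦ (<-trans (NF-base< nf′) m<y) t↦)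
      ...   | inj₂ refl with refl ← notation-unique s↦ u↦ = base (rec (NF-base< nf)
                (A-cancel-< a (≤-<-trans (chain-base≤ (fromNFChain mch)) m<y)) t↦ v↦)

    -- A number from the head of `n` up to `n` shares that head, so remainders decide; a smaller
    -- number lies below the head already.
    ordered-step : Ordered n
    ordered-step {m} m<n s↦ (node {a = c} {d} {q} nf@(_ , n≡ , nch) u↦ v↦ w↦) with m <? A k c d
    ... | yes m<y = below (below-head-≺ nf u↦ v↦ m<y s↦)
    ... | no  m≮y with ≮⇒≥ m≮y | notation-exists (m ∸ A k c d)
    ...   | y≤m | r , r↦
      with refl ← notation-unique s↦
             (node (NF-intro (chain-shrink y≤m (<⇒≤ m<n) (fromNFChain nch))) u↦ v↦ r↦) =
      rest (rec (NF-rest< nf) m∸y<q r↦ w↦)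
      where
      m∸y<q : m ∸ A k c d < q
      m∸y<q = +-cancelˡ-< (A k c d) _ _ (subst₂ _<_ (sym (m+[n∸m]≡n y≤m)) n≡ m<n)

  notation-ordered : ∀ n → Ordered n
  notation-ordered = <-rec Ordered λ n rec → ordered-step rec

  rebase : ℕ → ℕ → ℕ
  rebase ℓ m = eval ℓ (proj₁ (notation-exists m))

  eval-rebase : ∀ ℓ {t m} → Notation k t m → eval ℓ t ≡ rebase ℓ m
  eval-rebase ℓ {m = m} t↦ = cong (eval ℓ) (notation-unique t↦ (proj₂ (notation-exists m)))

  rebase-NF : ∀ ℓ {m a b c} → NF k m a b c →
              rebase ℓ m ≡ A ℓ (rebase ℓ a) (rebase ℓ b) + rebase ℓ c
  rebase-NF ℓ {a = a} {b} {c} nf = sym (eval-rebase ℓ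
    (node nf (proj₂ (notation-exists a)) (proj₂ (notation-exists b)) (proj₂ (notation-exists c))))

  module _ (ℓ : ℕ) (k<ℓ : k < ℓ) where

    open BaseChangeFunction k ℓ 2≤k k<ℓ (rebase ℓ) (sym (eval-rebase ℓ zero)) (rebase-NF ℓ)
      using (f-infl; NF-preserved)

    notation-rebased : ∀ {t m} → Notation k t m → Notation ℓ t (rebase ℓ m)
    notation-rebased zero = subst (Notation ℓ O) (eval-rebase ℓ zero) zero
    notation-rebased (node nf s↦ t↦ r↦) =
      node (NF-preserved nf) (notation-rebased s↦) (notation-rebased t↦) (notation-rebased r↦)

    notation-eval : ∀ {t m} → Notation k t m → Notation ℓ t (eval ℓ t) × m ≤ eval ℓ t
    notation-eval {t} {m} t↦ =
      subst (λ v → Notation ℓ t v × m ≤ v) (sym (eval-rebase ℓ t↦)) (notation-rebased t↦ , f-infl m)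

-- Termination of Goodstein sequences

goodstein-terminates : ∀ {m i x t} → Acc _≺_ t → Notation (i + 2) t x → Goodstein m i x →
                       ∃ λ j → Goodstein m j 0
goodstein-terminates {i = i} {zero}  _ _ g = i , g
goodstein-terminates {m} {i} {suc x} {t} (acc rs) t↦ g =
  let t↦y , x<y = Notations.notation-eval (i + 2) (m≤n+m 2 i) (i + 3) (+-monoʳ-< i (n<1+n 2)) t↦
      open Notations (suc i + 2) (m≤n+m 2 (suc i))
      y = eval (i + 3) t
      s , s↦ = notation-exists (y ∸ 1)
      t↦y′ = subst (λ k → Notation k t y) (+-suc i 2) t↦y
      -- `suc x ≤ y` makes `y` positive, so `y ∸ 1` is a strict decrease.
      s≺t = notation-ordered y (∸-monoʳ-< z<s (≤-trans (s≤s z≤n) x<y)) s↦ t↦y′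
  in goodstein-terminates (rs s≺t) s↦ (g-suc g z<s (notation-baseChange t↦))

theorem2p9 : (m : ℕ) → ∃ λ i → Goodstein m i 0
theorem2p9 m = goodstein-terminates (≺-wellFounded t) t↦ g-zero
  where
  t  = proj₁ (Notations.notation-exists 2 ≤-refl m)
  t↦ = proj₂ (Notations.notation-exists 2 ≤-refl m)
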